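{- There is no structure $\langle\mathbb N,\oplus,\otimes\rangle$ with $\oplus,\otimes$ computable binary operations on $\mathbb N$, together with a co-c.e. equivalence relation $E$ on $\mathbb N$ that is a congruence with respect to $\oplus$ and $\otimes$, such that the quotient $\langle\mathbb N,\oplus,\otimes\rangle/E$ is a nonstandard model of true arithmetic.
   Context: A co-c.e. relation is one whose complement is computably enumerable. A model of true arithmetic is a structure (here in the language $\{+,\cdot\}$) satisfying exactly the same first-order sentences as the standard model of arithmetic; nonstandard means not isomorphic to the standard model. -}

module Defs where

open import Level using (0ℓ)
open import Data.Nat using (ℕ; zero; suc; _+_; _*_; _<_)
open import Data.Fin using (Fin)
open import Data.Vec using (Vec; []; _∷_; lookup)
open import Data.Product using (Σ; ∃; _×_; _,_)
open import Data.Sum using (_⊎_)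
open import Data.Empty using (⊥)
open import Relation.Nullary using (¬_)
open import Relation.Binary.PropositionalEquality using (_≡_)
open import Relation.Binary.Structures using (IsEquivalence)

data Code : ℕ → Set where
  zeroᶜ : ∀ {n} → Code n
  succᶜ : Code 1
  proj  : ∀ {n} → Fin n → Code n
  comp  : ∀ {m n} → Code m → Vec (Code n) m → Code n
  prim  : ∀ {n} → Code n → Code (suc (suc n)) → Code (suc n)
  mu    : ∀ {n} → Code (suc n) → Code n

mutual
  data Eval : ∀ {n} → Code n → Vec ℕ n → ℕ → Set where
    ev-zero : ∀ {n} {xs : Vec ℕ n} → Eval zeroᶜ xs 0
    ev-succ : ∀ {x} → Eval succᶜ (x ∷ []) (suc x)
    ev-proj : ∀ {n} {xs : Vec ℕ n} (i : Fin n) → Eval (proj i) xs (lookup xs i)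
    ev-comp : ∀ {m n} {f : Code m} {gs : Vec (Code n) m} {xs : Vec ℕ n}
                {ys : Vec ℕ m} {v : ℕ} →
              EvalAll gs xs ys → Eval f ys v → Eval (comp f gs) xs v
    ev-prim-z : ∀ {n} {f : Code n} {g : Code (suc (suc n))} {xs : Vec ℕ n} {v} →
                Eval f xs v → Eval (prim f g) (0 ∷ xs) v
    ev-prim-s : ∀ {n} {f : Code n} {g : Code (suc (suc n))} {xs : Vec ℕ n} {k u v} →
                Eval (prim f g) (k ∷ xs) u → Eval g (k ∷ u ∷ xs) v →
                Eval (prim f g) (suc k ∷ xs) v
    ev-mu : ∀ {n} {f : Code (suc n)} {xs : Vec ℕ n} {k} →
            Eval f (k ∷ xs) 0 →
            (∀ m → m < k → ∃ λ j → Eval f (m ∷ xs) (suc j)) →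
            Eval (mu f) xs k

  data EvalAll {n} : ∀ {m} → Vec (Code n) m → Vec ℕ n → Vec ℕ m → Set where
    []  : ∀ {xs} → EvalAll [] xs []
    _∷_ : ∀ {m} {g : Code n} {gs : Vec (Code n) m} {xs y ys} →
          Eval g xs y → EvalAll gs xs ys → EvalAll (g ∷ gs) xs (y ∷ ys)

Computable₂ : (ℕ → ℕ → ℕ) → Set
Computable₂ f = Σ (Code 2) λ c → ∀ x y → Eval c (x ∷ y ∷ []) (f x y)

CE₂ : (ℕ → ℕ → Set) → Set
CE₂ R = Σ (Code 2) λ c → ∀ x y →
          (R x y → ∃ λ v → Eval c (x ∷ y ∷ []) v) ×
          ((∃ λ v → Eval c (x ∷ y ∷ []) v) → R x y)

CoCE₂ : (ℕ → ℕ → Set) → Set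
CoCE₂ R = CE₂ (λ x y → ¬ R x y)

record Structure : Set₁ where
  field
    Carrier : Set
    _≈_     : Carrier → Carrier → Set
    _⊕_     : Carrier → Carrier → Carrier
    _⊗_     : Carrier → Carrier → Carrier

ℕ-std : Structure
ℕ-std = record { Carrier = ℕ ; _≈_ = _≡_ ; _⊕_ = _+_ ; _⊗_ = _*_ }

-- the quotient ⟨ℕ,⊕,⊗⟩/E : elements are represented by natural numbers,
-- equality of the quotient is E (well defined when E is a congruence)
Quot : (ℕ → ℕ → ℕ) → (ℕ → ℕ → ℕ) → (ℕ → ℕ → Set) → Structure
Quot f g E = record { Carrier = ℕ ; _≈_ = E ; _⊕_ = f ; _⊗_ = g }

Congruence : (ℕ → ℕ → ℕ) → (ℕ → ℕ → ℕ) → (ℕ → ℕ → Set) → Set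
Congruence f g E = ∀ {a a′ b b′} → E a a′ → E b b′ → E (f a b) (f a′ b′) × E (g a b) (g a′ b′)

data Term (n : ℕ) : Set where
  var  : Fin n → Term n
  _+ᵗ_ : Term n → Term n → Term n
  _*ᵗ_ : Term n → Term n → Term n

data Formula : ℕ → Set where
  _≐_  : ∀ {n} → Term n → Term n → Formula n
  ⊥ᶠ   : ∀ {n} → Formula n
  _⇒_  : ∀ {n} → Formula n → Formula n → Formula n
  _∧ᶠ_ : ∀ {n} → Formula n → Formula n → Formula n
  _∨ᶠ_ : ∀ {n} → Formula n → Formula n → Formula n
  ∀ᶠ   : ∀ {n} → Formula (suc n) → Formula n
  ∃ᶠ   : ∀ {n} → Formula (suc n) → Formula n

Sentence : Set
Sentence = Formula 0

module _ (M : Structure) where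
  open Structure M

  ⟦_⟧ᵗ : ∀ {n} → Term n → Vec Carrier n → Carrier
  ⟦ var i ⟧ᵗ ρ = lookup ρ i
  ⟦ s +ᵗ t ⟧ᵗ ρ = ⟦ s ⟧ᵗ ρ ⊕ ⟦ t ⟧ᵗ ρ
  ⟦ s *ᵗ t ⟧ᵗ ρ = ⟦ s ⟧ᵗ ρ ⊗ ⟦ t ⟧ᵗ ρ

  Sat : ∀ {n} → Formula n → Vec Carrier n → Set
  Sat (s ≐ t) ρ = ⟦ s ⟧ᵗ ρ ≈ ⟦ t ⟧ᵗ ρ
  Sat ⊥ᶠ ρ = ⊥
  Sat (φ ⇒ ψ) ρ = Sat φ ρ → Sat ψ ρ
  Sat (φ ∧ᶠ ψ) ρ = Sat φ ρ × Sat ψ ρ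
  Sat (φ ∨ᶠ ψ) ρ = Sat φ ρ ⊎ Sat ψ ρ
  Sat (∀ᶠ φ) ρ = (a : Carrier) → Sat φ (a ∷ ρ)
  Sat (∃ᶠ φ) ρ = Σ Carrier λ a → Sat φ (a ∷ ρ)

  Models : Sentence → Set
  Models σ = Sat σ []

ModelOfTA : Structure → Set
ModelOfTA M = ∀ (σ : Sentence) → (Models ℕ-std σ → Models M σ) × (Models M σ → Models ℕ-std σ)

record IsoToStd (M : Structure) : Set where
  open Structure M
  field
    h       : ℕ → Carrier
    inj     : ∀ a b → h a ≈ h b → a ≡ b
    surj    : ∀ y → Σ ℕ λ a → h a ≈ y
    pres-+  : ∀ a b → h (a + b) ≈ (h a ⊕ h b)
    pres-*  : ∀ a b → h (a * b) ≈ (h a ⊗ h b)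

NonstandardModelOfTA : Structure → Set
NonstandardModelOfTA M = ModelOfTA M × ¬ IsoToStd M

{-# OPTIONS --safe #-}
-- The hypotheses make ⊕, ⊗ and E first-order definable in ℕ (Gödel's β-function handles primitive
-- recursion), hence so is satisfaction in M = ⟨ℕ,⊕,⊗⟩/E of any fixed formula.  Let Bit(n,a,b) say
-- β a b n = 0, let ν n be a representative of the n-th numeral of M, and let α define the relation
-- M ⊭ Bit(ν n, n, p) on pairs of natural numbers (n,p).  In ℕ it is true that for every k some b is
-- such that for every p some a satisfies Bit(n,a,b) ↔ α(n,p) for all n ≤ k.  Read this in M with k
-- nonstandard: get b, put p = ν b, and get a.  For n = ν a it says that M ⊨ Bit(ν a, a, b) iff
-- M ⊨ α(ν a, ν b), that is iff M ⊭ Bit(ν a, a, b).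
module Submission where

open import Defs
open import Level using (0ℓ)
open import Axiom.ExcludedMiddle using (ExcludedMiddle)
open import Data.Nat
open import Data.Nat.Coprimality using (Coprime; coprime-Bézout; coprime-divisor)
open import Data.Nat.Divisibility
open import Data.Nat.DivMod using ([m+kn]%n≡m%n; m≤n⇒m%n≡m; m≡m%n+[m/n]*n; m%n<n)
open import Data.Nat.GCD using (module Bézout)
open import Data.Nat.Properties
open import Data.Nat.Tactic.RingSolver using (solve-∀)
open import Data.Empty using (⊥)
open import Data.Fin using (Fin; zero; suc; _↑ˡ_; _↑ʳ_; #_)
open import Data.Product as Product using (∃; _×_; _,_; proj₁; proj₂)
open import Data.Sum as Sum using (_⊎_; inj₁; inj₂)
open import Data.Vec using (Vec; []; _∷_; _++_; lookup; head; tail; tabulate; map)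
open import Data.Vec.Properties
  using (lookup-++ˡ; lookup-++ʳ; tabulate∘lookup; tabulate-cong; lookup∘tabulate)
open import Function using (_∘_; id; _⇔_; mk⇔; Equivalence)
open import Function.Properties.Equivalence using () renaming (refl to ⇔-refl; sym to ⇔-sym; trans to ⇔-trans)
open import Relation.Nullary using (¬_; Dec; yes; no; contradiction)
open import Relation.Nullary.Decidable using (decidable-stable)
open import Relation.Binary.Definitions using (tri<; tri≈; tri>)
open import Relation.Binary.PropositionalEquality
open import Relation.Binary.Structures using (IsEquivalence)

open Equivalence using (to; from)

-- Gödel's β-function

modulus : ℕ → ℕ → ℕ
modulus b i = suc (suc i * b)

β : ℕ → ℕ → ℕ → ℕ
β a b i = a % modulus b i

coprime-* : ∀ {d m n} → Coprime d m → Coprime d n → Coprime d (m * n)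
coprime-* c c′ (e∣d , e∣mn) =
  c′ (e∣d , coprime-divisor (λ (g∣e , g∣m) → c (∣-trans g∣e e∣d , g∣m)) e∣mn)

-- Cross-multiplying the two moduli by `suc i` and `suc k` cancels `b` and leaves the difference of
-- indices. A common divisor `e` therefore divides `suc j`, hence `b`, and a divisor of `b` and of a
-- modulus divides 1.
modulus-coprime : ∀ {b i j} → suc j ∣ b → Coprime (modulus b (i + suc j)) (modulus b i)
modulus-coprime {b} {i} {j} j∣b {e} (p , q) = ∣1⇒≡1 (∣m+n∣m⇒∣n (subst (e ∣_) (+-comm 1 _) p) e∣kb)
  where
  k = i + suc j
  identity : ∀ i j b → suc (i + suc j) * (1 + suc i * b) ≡ suc i * (1 + suc (i + suc j) * b) + suc j
  identity = solve-∀
  e∣j : e ∣ suc j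
  e∣j = ∣m+n∣m⇒∣n (subst (e ∣_) (identity i j b) (∣n⇒∣m*n (suc k) q)) (∣n⇒∣m*n (suc i) p)
  e∣kb : e ∣ suc k * b
  e∣kb = ∣n⇒∣m*n (suc k) (∣-trans e∣j j∣b)

modular-inverse : ∀ {d D} → Coprime (suc d) D → ∃ λ x → ∃ λ p → ∃ λ q → x * D + p * suc d ≡ 1 + q * suc d
modular-inverse {d} {D} c with coprime-Bézout c
-- Here `y` inverts `D` up to sign; since `d` is -1 modulo `suc d`, the factor `d` corrects the
-- sign.
... | Bézout.+- x y eq = d * y , 1 , d * x ,
      trans (identity d y D) (cong suc (trans (cong (d *_) eq) (sym (*-assoc d x (suc d)))))
  where
  identity : ∀ d y D → d * y * D + 1 * suc d ≡ 1 + d * (1 + y * D)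
  identity = solve-∀
... | Bézout.-+ x y eq = y , 0 , x , trans (+-identityʳ _) (sym eq)

shift-residue : ∀ {d D} → Coprime (suc d) D → ∀ a {u} → u ≤ d → ∃ λ t → (a + t * D) % suc d ≡ u
shift-residue {d} {D} c a {u} u≤d with modular-inverse c
... | x , p , q , eq = x * w , (begin
  (a + x * w * D) % suc d                      ≡⟨ [m+kn]%n≡m%n (a + x * w * D) (p * w) (suc d) ⟨
  (a + x * w * D + p * w * suc d) % suc d      ≡⟨ cong (_% suc d) (identity₁ a x w D p d) ⟩
  (a + w * (x * D + p * suc d)) % suc d        ≡⟨ cong (λ z → (a + w * z) % suc d) eq ⟩
  (a + w * (1 + q * suc d)) % suc d            ≡⟨ cong (_% suc d) (identity₂ a u q d) ⟩
  (u + (a + w * q) * suc d) % suc d            ≡⟨ [m+kn]%n≡m%n u (a + w * q) (suc d) ⟩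
  u % suc d                                    ≡⟨ m≤n⇒m%n≡m u≤d ⟩
  u                                            ∎)
  where
  open ≡-Reasoning
  -- Modulo `suc d` this is `u - a`, written without subtraction.
  w = u + d * a
  identity₁ : ∀ a x w D p d → a + x * w * D + p * w * suc d ≡ a + w * (x * D + p * suc d)
  identity₁ = solve-∀
  identity₂ : ∀ a u q d → a + (u + d * a) * (1 + q * suc d) ≡ u + (a + (u + d * a) * q) * suc d
  identity₂ = solve-∀

-- D is a common multiple of the first m moduli; adding multiples of it leaves the earlier residues unchanged.
chinese-remainder : ∀ {d f : ℕ → ℕ} {K} → (∀ i → i ≤ K → f i ≤ d i) →
  (∀ i j → i < j → j ≤ K → Coprime (suc (d j)) (suc (d i))) →
  ∀ m → m ≤ suc K → ∃ λ a → ∃ λ D →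
  (∀ i → i < m → a % suc (d i) ≡ f i × suc (d i) ∣ D) ×
  (∀ j → m ≤ j → j ≤ K → Coprime (suc (d j)) D)
chinese-remainder f≤d cop zero _ = 0 , 1 , (λ _ ()) , (λ _ _ _ (_ , e∣1) → ∣1⇒≡1 e∣1)
chinese-remainder {d} {f} {K} f≤d cop (suc m) (s≤s m≤K) =
  let a , D , residues , coprime = chinese-remainder f≤d cop m (m≤n⇒m≤1+n m≤K)
      t , eq = shift-residue (coprime m ≤-refl m≤K) a (f≤d m m≤K)
  in a + t * D , D * suc (d m) , residues′ a D t residues eq ,
     λ j m<j j≤K → coprime-* (coprime j (<⇒≤ m<j) j≤K) (cop m j m<j j≤K)
  where
  residues′ : ∀ a D t → (∀ i → i < m → a % suc (d i) ≡ f i × suc (d i) ∣ D) →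
              (a + t * D) % suc (d m) ≡ f m →
              ∀ i → i < suc m → (a + t * D) % suc (d i) ≡ f i × suc (d i) ∣ D * suc (d m)
  residues′ a D t residues eq i (s≤s i≤m) with m≤n⇒m<n∨m≡n i≤m
  ... | inj₂ refl = eq , n∣m*n D
  ... | inj₁ i<m with residues i i<m
  ... | res , i∣D@(divides k refl) =
    trans (trans (cong (λ z → (a + z) % suc (d i)) (sym (*-assoc t k _)))
                 ([m+kn]%n≡m%n a (t * k) (suc (d i)))) res ,
    ∣m⇒∣m*n _ i∣D

1+n∣K! : ∀ {n K} → n < K → suc n ∣ K !
1+n∣K! {n} n<K = ∣-trans (m∣m*n (n !)) (m≤n⇒m!∣n! n<K)

-- b depends only on the length and on a bound for the values, not on the sequence.
β-function : ∀ K B → ∃ λ b → ∀ (f : ℕ → ℕ) → (∀ i → i ≤ K → f i ≤ B) →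
             ∃ λ a → ∀ i → i ≤ K → β a b i ≡ f i
β-function K B = b , code
  where
  -- The factor `K !` is divisible by every difference of two indices, which makes the moduli
  -- coprime; the factor `B` makes every modulus exceed the values.
  b = K ! * B
  coprime : ∀ i j → i < j → j ≤ K → Coprime (modulus b j) (modulus b i)
  coprime i j i<j j≤K with o , refl ← m≤n⇒∃[o]m+o≡n i<j =
    subst (λ k → Coprime (modulus b k) (modulus b i)) (+-suc i o)
      (modulus-coprime {i = i} (∣m⇒∣m*n B (1+n∣K! (≤-trans (s≤s (m≤n+m o i)) j≤K))))
  code : ∀ (f : ℕ → ℕ) → (∀ i → i ≤ K → f i ≤ B) → ∃ λ a → ∀ i → i ≤ K → β a b i ≡ f i
  code f f≤B =
    let f≤d i i≤K = ≤-trans (f≤B i i≤K) (≤-trans (m≤n*m B (K !) {{K !≢0}}) (m≤m+n b (i * b)))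
        a , _ , residues , _ = chinese-remainder f≤d coprime (suc K) ≤-refl
    in a , λ i i≤K → proj₁ (residues i (s≤s i≤K))

bounded : ∀ (f : ℕ → ℕ) K → ∃ λ B → ∀ i → i ≤ K → f i ≤ B
bounded f zero = f 0 , λ { _ z≤n → ≤-refl }
bounded f (suc K) with B , f≤B ← bounded f K = B ⊔ f (suc K) , f≤B′
  where
  f≤B′ : ∀ i → i ≤ suc K → f i ≤ B ⊔ f (suc K)
  f≤B′ i i≤1+K with m≤n⇒m<n∨m≡n i≤1+K
  ... | inj₁ (s≤s i≤K) = ≤-trans (f≤B i i≤K) (m≤m⊔n B _)
  ... | inj₂ refl = m≤n⊔m B _

-- Single-valuedness of evaluation

mutual
  Eval-functional : ∀ {n} {c : Code n} {xs u v} → Eval c xs u → Eval c xs v → u ≡ v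
  Eval-functional ev-zero ev-zero = refl
  Eval-functional ev-succ ev-succ = refl
  Eval-functional (ev-proj i) (ev-proj .i) = refl
  Eval-functional (ev-comp gs f) (ev-comp gs′ f′) with refl ← EvalAll-functional gs gs′ = Eval-functional f f′
  Eval-functional (ev-prim-z f) (ev-prim-z f′) = Eval-functional f f′
  Eval-functional (ev-prim-s r g) (ev-prim-s r′ g′) with refl ← Eval-functional r r′ = Eval-functional g g′
  Eval-functional (ev-mu {k = k} f nz) (ev-mu {k = k′} f′ nz′) with <-cmp k k′
  ... | tri≈ _ k≡k′ _ = k≡k′
  -- If the two minima differ, `f` takes both 0 and a successor as value at the smaller one.
  ... | tri< k<k′ _ _ with () ← Eval-functional f (proj₂ (nz′ k k<k′))
  ... | tri> _ _ k′<k with () ← Eval-functional (proj₂ (nz k′ k′<k)) f′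

  EvalAll-functional : ∀ {m n} {gs : Vec (Code n) m} {xs ys zs} → EvalAll gs xs ys → EvalAll gs xs zs → ys ≡ zs
  EvalAll-functional [] [] = refl
  EvalAll-functional (e ∷ es) (e′ ∷ es′) = cong₂ _∷_ (Eval-functional e e′) (EvalAll-functional es es′)

-- Renaming of variables

lift : ∀ {m n} → (Fin m → Fin n) → Fin (suc m) → Fin (suc n)
lift σ zero = zero
lift σ (suc i) = suc (σ i)

renameᵗ : ∀ {m n} → (Fin m → Fin n) → Term m → Term n
renameᵗ σ (var i) = var (σ i)
renameᵗ σ (s +ᵗ t) = renameᵗ σ s +ᵗ renameᵗ σ t
renameᵗ σ (s *ᵗ t) = renameᵗ σ s *ᵗ renameᵗ σ t

rename : ∀ {m n} → (Fin m → Fin n) → Formula m → Formula n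
rename σ (s ≐ t) = renameᵗ σ s ≐ renameᵗ σ t
rename σ ⊥ᶠ = ⊥ᶠ
rename σ (φ ⇒ ψ) = rename σ φ ⇒ rename σ ψ
rename σ (φ ∧ᶠ ψ) = rename σ φ ∧ᶠ rename σ ψ
rename σ (φ ∨ᶠ ψ) = rename σ φ ∨ᶠ rename σ ψ
rename σ (∀ᶠ φ) = ∀ᶠ (rename (lift σ) φ)
rename σ (∃ᶠ φ) = ∃ᶠ (rename (lift σ) φ)

module _ (M : Structure) where
  open Structure M

  renameᵗ-eval : ∀ {m n} (σ : Fin m → Fin n) (t : Term m) {ρ ρ′} → (∀ i → lookup ρ (σ i) ≡ lookup ρ′ i) →
                 ⟦_⟧ᵗ M (renameᵗ σ t) ρ ≡ ⟦_⟧ᵗ M t ρ′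
  renameᵗ-eval σ (var i) eq = eq i
  renameᵗ-eval σ (s +ᵗ t) eq = cong₂ _⊕_ (renameᵗ-eval σ s eq) (renameᵗ-eval σ t eq)
  renameᵗ-eval σ (s *ᵗ t) eq = cong₂ _⊗_ (renameᵗ-eval σ s eq) (renameᵗ-eval σ t eq)

  lift-lookup : ∀ {m n} (σ : Fin m → Fin n) {ρ ρ′} → (∀ i → lookup ρ (σ i) ≡ lookup ρ′ i) →
                ∀ {a : Carrier} i → lookup (a ∷ ρ) (lift σ i) ≡ lookup (a ∷ ρ′) i
  lift-lookup σ eq zero = refl
  lift-lookup σ eq (suc i) = eq i

  -- The environments are compared only pointwise, a condition that survives passage under a
  -- quantifier. The structure is arbitrary because both ℕ and the quotient are needed later.
  rename-sat : ∀ {m n} (σ : Fin m → Fin n) (φ : Formula m) {ρ ρ′} → (∀ i → lookup ρ (σ i) ≡ lookup ρ′ i) →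
               Sat M (rename σ φ) ρ ⇔ Sat M φ ρ′
  rename-sat σ (s ≐ t) eq = mk⇔ (subst₂ _≈_ (renameᵗ-eval σ s eq) (renameᵗ-eval σ t eq))
                                (subst₂ _≈_ (sym (renameᵗ-eval σ s eq)) (sym (renameᵗ-eval σ t eq)))
  rename-sat σ ⊥ᶠ eq = ⇔-refl
  rename-sat σ (φ ⇒ ψ) eq =
    mk⇔ (λ f → to (rename-sat σ ψ eq) ∘ f ∘ from (rename-sat σ φ eq))
        (λ f → from (rename-sat σ ψ eq) ∘ f ∘ to (rename-sat σ φ eq))
  rename-sat σ (φ ∧ᶠ ψ) eq = mk⇔ (Product.map (to (rename-sat σ φ eq)) (to (rename-sat σ ψ eq)))
                                 (Product.map (from (rename-sat σ φ eq)) (from (rename-sat σ ψ eq)))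
  rename-sat σ (φ ∨ᶠ ψ) eq = mk⇔ (Sum.map (to (rename-sat σ φ eq)) (to (rename-sat σ ψ eq)))
                                 (Sum.map (from (rename-sat σ φ eq)) (from (rename-sat σ ψ eq)))
  rename-sat σ (∀ᶠ φ) eq =
    mk⇔ (λ f a → to (rename-sat (lift σ) φ (lift-lookup σ eq)) (f a))
        (λ f a → from (rename-sat (lift σ) φ (lift-lookup σ eq)) (f a))
  rename-sat σ (∃ᶠ φ) eq =
    mk⇔ (λ (a , s) → a , to (rename-sat (lift σ) φ (lift-lookup σ eq)) s)
        (λ (a , s) → a , from (rename-sat (lift σ) φ (lift-lookup σ eq)) s)

-- Definable predicates and functions

record Def {n} (P : Vec ℕ n → Set) : Set where
  constructor def
  field
    formula : Formula n
    sat⇔    : ∀ ρ → Sat ℕ-std formula ρ ⇔ P ρ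
open Def public

iffD : ∀ {n} {P Q : Vec ℕ n → Set} → Def P → (∀ ρ → P ρ ⇔ Q ρ) → Def Q
iffD (def φ s) e = def φ (λ ρ → ⇔-trans (s ρ) (e ρ))

renD : ∀ {m n} {P : Vec ℕ m → Set} (σ : Fin m → Fin n) → Def P → Def (λ ρ → P (tabulate (lookup ρ ∘ σ)))
renD σ (def φ s) = def (rename σ φ) λ ρ →
  ⇔-trans (rename-sat ℕ-std σ φ (λ i → sym (lookup∘tabulate (lookup ρ ∘ σ) i))) (s _)

⊥D : ∀ {n} → Def {n} (λ _ → ⊥)
⊥D = def ⊥ᶠ λ _ → ⇔-refl

infixr 6 _⇒D_
infixr 7 _⊎D_
infixr 8 _×D_

_⇒D_ : ∀ {n} {P Q : Vec ℕ n → Set} → Def P → Def Q → Def (λ ρ → P ρ → Q ρ)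
def φ s ⇒D def ψ t = def (φ ⇒ ψ) λ ρ → mk⇔ (λ f → to (t ρ) ∘ f ∘ from (s ρ)) (λ f → from (t ρ) ∘ f ∘ to (s ρ))

_×D_ : ∀ {n} {P Q : Vec ℕ n → Set} → Def P → Def Q → Def (λ ρ → P ρ × Q ρ)
def φ s ×D def ψ t = def (φ ∧ᶠ ψ) λ ρ →
  mk⇔ (Product.map (to (s ρ)) (to (t ρ))) (Product.map (from (s ρ)) (from (t ρ)))

_⊎D_ : ∀ {n} {P Q : Vec ℕ n → Set} → Def P → Def Q → Def (λ ρ → P ρ ⊎ Q ρ)
def φ s ⊎D def ψ t = def (φ ∨ᶠ ψ) λ ρ →
  mk⇔ (Sum.map (to (s ρ)) (to (t ρ))) (Sum.map (from (s ρ)) (from (t ρ)))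

∀D : ∀ {n} {P : Vec ℕ (suc n) → Set} → Def P → Def (λ ρ → ∀ x → P (x ∷ ρ))
∀D (def φ s) = def (∀ᶠ φ) λ ρ → mk⇔ (λ f x → to (s _) (f x)) (λ f x → from (s _) (f x))

∃D : ∀ {n} {P : Vec ℕ (suc n) → Set} → Def P → Def (λ ρ → ∃ λ x → P (x ∷ ρ))
∃D (def φ s) = def (∃ᶠ φ) λ ρ → mk⇔ (Product.map₂ (to (s _))) (Product.map₂ (from (s _)))

∃VecD : ∀ {m n} {P : Vec ℕ (m + n) → Set} → Def P → Def (λ ρ → ∃ λ (ys : Vec ℕ m) → P (ys ++ ρ))
∃VecD {zero} d = iffD d (λ _ → mk⇔ ([] ,_) λ { ([] , p) → p })
∃VecD {suc m} {P = P} d =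
  iffD (∃VecD {m} (∃D d)) (λ ρ → mk⇔ (λ (ys , y , p) → y ∷ ys , p) λ { (y ∷ ys , p) → ys , y , p })

∀FinD : ∀ {m n} {P : Fin m → Vec ℕ n → Set} → (∀ i → Def (P i)) → Def (λ ρ → ∀ i → P i ρ)
-- The syntax has no formula for truth, so `⊥ᶠ ⇒ ⊥ᶠ` serves as the empty conjunction.
∀FinD {zero} d = iffD (⊥D ⇒D ⊥D) (λ _ → mk⇔ (λ _ ()) (λ _ ()))
∀FinD {suc m} d =
  iffD (d zero ×D ∀FinD (d ∘ suc))
       (λ ρ → mk⇔ (λ { (p , q) zero → p ; (p , q) (suc i) → q i }) (λ f → f zero , f ∘ suc))

-- Intermediate values are quantified existentially. The `G i` need not be graphs of total
-- functions, so the lemma also covers composition of partial codes.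
relational-substD : ∀ {m n} {P : Vec ℕ m → Set} {G : Fin m → Vec ℕ (suc n) → Set} →
  Def P → (∀ i → Def (G i)) → Def {n} (λ ρ → ∃ λ ys → (∀ i → G i (lookup ys i ∷ ρ)) × P ys)
relational-substD {m} {n} {P} {G} d g =
  iffD (∃VecD {m} (∀FinD (λ i → renD (σ i) (g i)) ×D renD (_↑ˡ n) d))
    (λ ρ → mk⇔ (Product.map₂ λ {ys} → to (unfold ρ ys)) (Product.map₂ λ {ys} → from (unfold ρ ys)))
  where
  σ : Fin m → Fin (suc n) → Fin (m + n)
  -- `G i` finds its value at the `i`-th new variable and its arguments among the old ones.
  σ i zero = i ↑ˡ n
  σ i (suc j) = m ↑ʳ j
  unfold : ∀ ρ ys → ((∀ i → G i (tabulate (lookup (ys ++ ρ) ∘ σ i))) ×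
                     P (tabulate (lookup (ys ++ ρ) ∘ (_↑ˡ n))))
                  ⇔ ((∀ i → G i (lookup ys i ∷ ρ)) × P ys)
  unfold ρ ys = mk⇔ (Product.map (λ f i → subst (G i) (args i) (f i)) (subst P ys≡))
                    (Product.map (λ f i → subst (G i) (sym (args i)) (f i)) (subst P (sym ys≡)))
    where
    ys≡ : tabulate (lookup (ys ++ ρ) ∘ (_↑ˡ n)) ≡ ys
    ys≡ = trans (tabulate-cong (lookup-++ˡ ys ρ)) (tabulate∘lookup ys)
    args : ∀ i → tabulate (lookup (ys ++ ρ) ∘ σ i) ≡ lookup ys i ∷ ρ
    args i = cong₂ _∷_ (lookup-++ˡ ys ρ i) (trans (tabulate-cong (lookup-++ʳ ys ρ)) (tabulate∘lookup ρ))

-- Definable functions and substitution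

record DFun {n} (t : Vec ℕ n → ℕ) : Set where
  constructor dfun
  field graph : Def (λ ρ → head ρ ≡ t (tail ρ))
open DFun public

record DEnv {m n} (e : Vec ℕ n → Vec ℕ m) : Set where
  constructor denv
  field component : ∀ i → DFun (λ ρ → lookup (e ρ) i)
open DEnv public

infixr 5 _∷E_

_∷E_ : ∀ {m n} {t : Vec ℕ n → ℕ} {e : Vec ℕ n → Vec ℕ m} → DFun t → DEnv e → DEnv (λ ρ → t ρ ∷ e ρ)
component (t ∷E e) zero = t
component (t ∷E e) (suc i) = component e i

[]E : ∀ {n} → DEnv {0} {n} (λ _ → [])
component []E ()

headF : ∀ {n} → DFun {suc n} head
headF = dfun (def (var zero ≐ var (suc zero)) λ { (_ ∷ _ ∷ _) → ⇔-refl })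

varF : ∀ {n} (i : Fin n) → DFun (λ ρ → lookup ρ i)
varF i = dfun (def (var zero ≐ var (suc i)) λ { (_ ∷ _) → ⇔-refl })

idE : ∀ {n} → DEnv {n} (λ ρ → ρ)
component idE = varF

weakenF : ∀ {n} {t : Vec ℕ n → ℕ} → DFun t → DFun (λ ρ → t (tail ρ))
weakenF {t = t} (dfun d) = dfun (iffD
  -- Position 0 holds the value of the function, so the fresh variable is inserted at position 1.
  (renD (λ { zero → zero ; (suc i) → suc (suc i) }) d)
  (λ { (z ∷ y ∷ ρ) → mk⇔ (subst (λ xs → z ≡ t xs) (tabulate∘lookup ρ))
                         (subst (λ xs → z ≡ t xs) (sym (tabulate∘lookup ρ))) }))

weakenE : ∀ {m n} {e : Vec ℕ n → Vec ℕ m} → DEnv e → DEnv (λ ρ → e (tail ρ))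
component (weakenE e) i = weakenF (component e i)

substD : ∀ {m n} {P : Vec ℕ m → Set} {e : Vec ℕ n → Vec ℕ m} → Def P → DEnv e → Def (λ ρ → P (e ρ))
substD {P = P} {e} d (denv g) = iffD
  (relational-substD d (graph ∘ g))
  (λ ρ → mk⇔ (λ (ys , eq , p) → subst P (ext eq) p) (λ p → e ρ , (λ _ → refl) , p))
  where
  ext : ∀ {m} {xs ys : Vec ℕ m} → (∀ i → lookup xs i ≡ lookup ys i) → xs ≡ ys
  ext {xs = xs} {ys} eq = trans (sym (tabulate∘lookup xs)) (trans (tabulate-cong eq) (tabulate∘lookup ys))

composeF : ∀ {m n} {F : Vec ℕ m → ℕ} {e : Vec ℕ n → Vec ℕ m} → DFun F → DEnv e → DFun (λ ρ → F (e ρ))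
composeF (dfun d) e = dfun (substD d (headF ∷E weakenE e))

-- The language has no constants: 0 is the solution of z + z = z, and 1 the other idempotent.
isZero isOne : ∀ {n} → Fin n → Formula n
isZero i = (var i +ᵗ var i) ≐ var i
isOne i = ((var i *ᵗ var i) ≐ var i) ∧ᶠ (isZero i ⇒ ⊥ᶠ)

double-fixed : ∀ z → (z + z ≡ z) ⇔ (z ≡ 0)
double-fixed z = mk⇔ (λ p → +-cancelˡ-≡ z z 0 (trans p (sym (+-identityʳ z)))) (λ { refl → refl })

idempotent-nonzero : ∀ z → (z * z ≡ z × (z + z ≡ z → ⊥)) ⇔ (z ≡ 1)
idempotent-nonzero zero = mk⇔ (λ (_ , nz) → contradiction refl nz) λ ()
idempotent-nonzero (suc z) =
  mk⇔ (λ (p , _) → *-cancelˡ-≡ (suc z) 1 (suc z) (trans p (sym (*-identityʳ (suc z))))) λ { refl → refl , λ () }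

zeroF : ∀ {n} → DFun {n} (λ _ → 0)
zeroF = dfun (def (isZero zero) λ { (z ∷ _) → double-fixed z })

oneF : ∀ {n} → DFun {n} (λ _ → 1)
oneF = dfun (def (isOne zero) λ { (z ∷ _) → idempotent-nonzero z })

_+F_ : ∀ {n} {s t : Vec ℕ n → ℕ} → DFun s → DFun t → DFun (λ ρ → s ρ + t ρ)
s +F t = composeF {F = λ ρ → head ρ + head (tail ρ)}
  (dfun (def (var zero ≐ (var (suc zero) +ᵗ var (suc (suc zero)))) λ { (_ ∷ _ ∷ _ ∷ []) → ⇔-refl })) (s ∷E t ∷E []E)

_*F_ : ∀ {n} {s t : Vec ℕ n → ℕ} → DFun s → DFun t → DFun (λ ρ → s ρ * t ρ)
s *F t = composeF {F = λ ρ → head ρ * head (tail ρ)}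
  (dfun (def (var zero ≐ (var (suc zero) *ᵗ var (suc (suc zero)))) λ { (_ ∷ _ ∷ _ ∷ []) → ⇔-refl })) (s ∷E t ∷E []E)

sucF : ∀ {n} {t : Vec ℕ n → ℕ} → DFun t → DFun (λ ρ → suc (t ρ))
sucF t = oneF +F t

infix 9 _≡D_ _≤D_

_≡D_ : ∀ {n} {s t : Vec ℕ n → ℕ} → DFun s → DFun t → Def (λ ρ → s ρ ≡ t ρ)
s ≡D t = substD {P = λ ρ → head ρ ≡ head (tail ρ)}
  (def (var zero ≐ var (suc zero)) λ { (_ ∷ _ ∷ []) → ⇔-refl }) (s ∷E t ∷E []E)

_≤D_ : ∀ {n} {s t : Vec ℕ n → ℕ} → DFun s → DFun t → Def (λ ρ → s ρ ≤ t ρ)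
_≤D_ {s = s′} {t′} s t = iffD (∃D ((weakenF s +F headF) ≡D weakenF t))
  (λ ρ → mk⇔ (λ (w , eq) → subst (s′ ρ ≤_) eq (m≤m+n (s′ ρ) w)) (λ le → m≤n⇒∃[o]m+o≡n le))

βF : ∀ {n} {a b i : Vec ℕ n → ℕ} → DFun a → DFun b → DFun i → DFun (λ ρ → β (a ρ) (b ρ) (i ρ))
βF {a = a} {b} {i} a′ b′ i′ = dfun (iffD
  (∃D (weakenF (weakenF a′) ≡D (weakenF headF +F (headF *F sucF (weakenF (weakenF d)))))
   ×D headF ≤D weakenF d)
  (λ { (u ∷ ρ) → remainder u (a ρ) (suc (i ρ) * b ρ) }))
  where
  d = sucF i′ *F b′
  remainder : ∀ u a d → ((∃ λ q → a ≡ u + q * suc d) × u ≤ d) ⇔ (u ≡ a % suc d)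
  remainder u a d =
    mk⇔ (λ { ((q , refl) , u≤d) → sym (trans ([m+kn]%n≡m%n u q (suc d)) (m≤n⇒m%n≡m u≤d)) })
        (λ { refl → (a / suc d , m≡m%n+[m/n]*n a (suc d)) , s≤s⁻¹ (m%n<n a (suc d)) })

-- Primitive recursion by coded computation traces

PrimTrace : ∀ {n} → Code n → Code (suc (suc n)) → Vec ℕ n → ℕ → ℕ → (ℕ → ℕ) → Set
PrimTrace f g xs k y h =
  Eval f xs (h 0) × (∀ i → suc i ≤ k → Eval g (i ∷ h i ∷ xs) (h (suc i))) × y ≡ h k

trace⇒Eval : ∀ {n} {f : Code n} {g xs k y h} → PrimTrace f g xs k y h → Eval (prim f g) (k ∷ xs) y
trace⇒Eval {f = f} {g} {xs} {k} {h = h} (start , step , refl) = go k ≤-refl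
  where
  go : ∀ i → i ≤ k → Eval (prim f g) (i ∷ xs) (h i)
  go zero _ = ev-prim-z start
  go (suc i) i<k = ev-prim-s (go i (<⇒≤ i<k)) (step i i<k)

_[_≔_] : (ℕ → ℕ) → ℕ → ℕ → ℕ → ℕ
(h [ k ≔ v ]) i with i ≟ k
... | yes _ = v
... | no _ = h i

updated : ∀ h k v → (h [ k ≔ v ]) k ≡ v
updated h k v with k ≟ k
... | yes _ = refl
... | no k≢k = contradiction refl k≢k

not-updated : ∀ h {k} v {i} → i < k → (h [ k ≔ v ]) i ≡ h i
not-updated h {k} v {i} i<k with i ≟ k
... | yes refl = contradiction i<k (<-irrefl refl)
... | no _ = refl

Trace-cong : ∀ {n} {f : Code n} {g xs k y h h′} → (∀ i → i ≤ k → h′ i ≡ h i) →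
             PrimTrace f g xs k y h → PrimTrace f g xs k y h′
Trace-cong {f = f} {g} {xs} {k} {h = h} eq (start , step , y≡) =
  subst (Eval f xs) (sym (eq 0 z≤n)) start ,
  (λ i i<k → subst₂ (λ u v → Eval g (i ∷ u ∷ xs) v) (sym (eq i (<⇒≤ i<k))) (sym (eq (suc i) i<k)) (step i i<k)) ,
  trans y≡ (sym (eq k ≤-refl))

Eval⇒trace : ∀ {n} {f : Code n} {g xs k y} → Eval (prim f g) (k ∷ xs) y → ∃ (PrimTrace f g xs k y)
Eval⇒trace {y = y} (ev-prim-z e) = (λ _ → y) , e , (λ _ ()) , refl
Eval⇒trace {f = f} {g} {xs} {suc k} {y} (ev-prim-s {u = u} e e′) =
  let h , tr = Eval⇒trace e
      start , step , u≡ = Trace-cong {h′ = h [ suc k ≔ y ]} (λ i i≤k → not-updated h y (s≤s i≤k)) tr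
  in h [ suc k ≔ y ] , start , extend h u≡ step , sym (updated h (suc k) y)
  where
  extend : ∀ h → u ≡ (h [ suc k ≔ y ]) k →
           (∀ i → suc i ≤ k → Eval g (i ∷ (h [ suc k ≔ y ]) i ∷ xs) ((h [ suc k ≔ y ]) (suc i))) →
           ∀ i → suc i ≤ suc k → Eval g (i ∷ (h [ suc k ≔ y ]) i ∷ xs) ((h [ suc k ≔ y ]) (suc i))
  extend h u≡ step i (s≤s i≤k) with m≤n⇒m<n∨m≡n i≤k
  ... | inj₁ i<k = step i i<k
  ... | inj₂ refl = subst₂ (λ u v → Eval g (k ∷ u ∷ xs) v) u≡ (sym (updated h (suc k) y)) e′

-- A quantifier over functions becomes one over pairs of numbers: only the finitely many values up
-- to `k` matter, they are bounded, and so some `β a b` agrees with them.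
Eval-prim⇔ : ∀ {n} {f : Code n} {g xs k y} →
  (∃ λ a → ∃ λ b → PrimTrace f g xs k y (β a b)) ⇔ Eval (prim f g) (k ∷ xs) y
Eval-prim⇔ {k = k} = mk⇔ (λ (_ , _ , tr) → trace⇒Eval tr) λ e →
  let h , tr = Eval⇒trace e
      B , h≤B = bounded h k
      b , code = β-function k B
      a , eq = code h h≤B
  in a , b , Trace-cong eq tr

EvalAll⇔ : ∀ {m n} {gs : Vec (Code n) m} {xs ys} →
           (∀ i → Eval (lookup gs i) xs (lookup ys i)) ⇔ EvalAll gs xs ys
EvalAll⇔ = mk⇔ collect project
  where
  collect : ∀ {m n} {gs : Vec (Code n) m} {xs ys} → (∀ i → Eval (lookup gs i) xs (lookup ys i)) → EvalAll gs xs ys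
  collect {gs = []} {ys = []} es = []
  collect {gs = _ ∷ _} {ys = _ ∷ _} es = es zero ∷ collect (es ∘ suc)
  project : ∀ {m n} {gs : Vec (Code n) m} {xs ys} → EvalAll gs xs ys → ∀ i → Eval (lookup gs i) xs (lookup ys i)
  project (e ∷ _) zero = e
  project (_ ∷ es) (suc i) = project es i

-- Definability of computable functions and co-c.e. relations

Graph : ∀ {n} → Code n → Vec ℕ (suc n) → Set
Graph c ρ = Eval c (tail ρ) (head ρ)

mutual
  graphD : ∀ {n} (c : Code n) → Def (Graph c)
  graphD zeroᶜ = iffD (headF ≡D zeroF) (λ { (y ∷ xs) → mk⇔ (λ { refl → ev-zero }) λ { ev-zero → refl } })
  graphD succᶜ = iffD (headF ≡D sucF (weakenF headF))
                      (λ { (y ∷ x ∷ []) → mk⇔ (λ { refl → ev-succ }) λ { ev-succ → refl } })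
  graphD (proj i) = iffD (headF ≡D weakenF (varF i))
                         (λ { (y ∷ xs) → mk⇔ (λ { refl → ev-proj i }) λ { (ev-proj .i) → refl } })
  graphD (comp f gs) =
    iffD (relational-substD
           -- Index `zero` carries the output along, since it is the first variable of the graph of
           -- `f`; the other indices are the values of `gs`.
           {G = λ { zero ρ → head ρ ≡ head (tail ρ)
                  ; (suc i) ρ → Graph (lookup gs i) (head ρ ∷ tail (tail ρ)) }}
           (graphD f)
           λ { zero → headF ≡D weakenF headF
             ; (suc i) → substD (graphsD gs i) (headF ∷E weakenE (weakenE idE)) })
         (λ { (y ∷ xs) → mk⇔ (λ { (z ∷ ys , es , e) →
                                  ev-comp (to EvalAll⇔ (es ∘ suc)) (subst (Eval f ys) (es zero) e) })
                             (λ { (ev-comp {ys = ys} es e) →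
                                  y ∷ ys , (λ { zero → refl ; (suc i) → from EvalAll⇔ es i }) , e }) })
  graphD (prim f g) =
    -- Under the two quantifiers the environment is `b ∷ a ∷ y ∷ k ∷ xs`.
    iffD (∃D (∃D (substD (graphD f) (βF a b zeroF ∷E weakenE (weakenE xs))
                  ×D ∀D (sucF headF ≤D weakenF k ⇒D
                         substD (graphD g) (βF (weakenF a) (weakenF b) (sucF headF) ∷E headF
                                            ∷E βF (weakenF a) (weakenF b) headF ∷E weakenE (weakenE (weakenE xs))))
                  ×D weakenF (weakenF headF) ≡D βF a b k)))
         (λ { (y ∷ k ∷ xs) → Eval-prim⇔ })
    where
    xs = weakenE (weakenE idE)
    b = headF
    a = weakenF headF
    k = weakenF (weakenF (weakenF headF))
  graphD (mu f) =
    iffD (substD (graphD f) (zeroF ∷E headF ∷E weakenE idE)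
          ×D ∀D (sucF headF ≤D weakenF headF ⇒D
                 ∃D (substD (graphD f) (sucF headF ∷E weakenF headF ∷E weakenE (weakenE (weakenE idE))))))
         (λ { (k ∷ xs) → mk⇔ (λ (e , nz) → ev-mu e nz) λ { (ev-mu e nz) → e , nz } })

  graphsD : ∀ {m n} (gs : Vec (Code n) m) i → Def (Graph (lookup gs i))
  graphsD (g ∷ _) zero = graphD g
  graphsD (_ ∷ gs) (suc i) = graphsD gs i

computableF : ∀ {n} (c : Code n) {F : Vec ℕ n → ℕ} → (∀ xs → Eval c xs (F xs)) → DFun F
computableF c ev = dfun (iffD (graphD c) λ
  { (y ∷ xs) → mk⇔ (λ e → Eval-functional e (ev xs)) λ { refl → ev xs } })

computable₂F : ∀ {_∙_ : ℕ → ℕ → ℕ} → Computable₂ _∙_ → DFun (λ ρ → head ρ ∙ head (tail ρ))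
computable₂F (c , ev) = computableF c λ { (x ∷ y ∷ []) → ev x y }

const : ∀ {n} → ℕ → Code n
const zero = zeroᶜ
const (suc k) = comp succᶜ (const k ∷ [])

const-eval : ∀ {n} {xs : Vec ℕ n} k → Eval (const k) xs k
const-eval zero = ev-zero
const-eval (suc k) = ev-comp (const-eval k ∷ []) ev-succ

-- `R` holds exactly where the code for its complement diverges, and divergence is the negation of
-- an existential over a definable graph. Recovering `R` from divergence is a double negation
-- elimination.
co-ceD : ExcludedMiddle 0ℓ → ∀ {R : ℕ → ℕ → Set} → CoCE₂ R → Def (λ ρ → R (head ρ) (head (tail ρ)))
co-ceD em (c , ce) = iffD (∃D (graphD c) ⇒D ⊥D) λ
  { (x ∷ y ∷ []) → mk⇔ (λ diverges → decidable-stable em (diverges ∘ proj₁ (ce x y)))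
                       (λ r converges → proj₂ (ce x y) converges r) }

-- The diagonal argument

-- Naming `n` by repeated addition of 1 replaces the missing constants: `numeral n ⇒ φ` under `∀ᶠ`
-- plays the role of substituting `n` into `φ`.
numeral : ∀ {m} → ℕ → Formula (suc m)
numeral zero = isZero zero
numeral (suc n) = ∃ᶠ (numeral n ∧ᶠ ∃ᶠ (isOne zero ∧ᶠ (var (# 2) ≐ (var (# 1) +ᵗ var (# 0)))))

numeral-std : ∀ {m} n {x} {ρ : Vec ℕ m} → Sat ℕ-std (numeral n) (x ∷ ρ) → x ≡ n
numeral-std zero s = to (double-fixed _) s
numeral-std (suc n) (y , s , o , one , eq) =
  trans eq (trans (cong₂ _+_ (numeral-std n s) (to (idempotent-nonzero o) one)) (+-comm n 1))

-- Characteristic functions share the bound 1, so a single `b` serves all sets `P`; excluded middle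
-- provides the characteristic function of each.
code-set : ExcludedMiddle 0ℓ → ∀ K → ∃ λ b → ∀ (P : ℕ → Set) → ∃ λ a → ∀ n → n ≤ K → P n ⇔ (β a b n ≡ 0)
code-set em K = let b , code = β-function K 1 in b , λ P →
  let a , eq = code (λ n → χ (em {P n})) (λ n _ → χ≤1 em)
  in a , λ n n≤K → subst (λ v → P n ⇔ (v ≡ 0)) (sym (eq n n≤K)) (χ⇔ em)
  where
  χ : ∀ {P : Set} → Dec P → ℕ
  χ (yes _) = 0
  χ (no _) = 1
  χ≤1 : ∀ {P : Set} (d : Dec P) → χ d ≤ 1
  χ≤1 (yes _) = z≤n
  χ≤1 (no _) = ≤-refl
  χ⇔ : ∀ {P : Set} (d : Dec P) → P ⇔ (χ d ≡ 0)
  χ⇔ (yes p) = mk⇔ (λ _ → refl) (λ _ → p)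
  χ⇔ (no ¬p) = mk⇔ (λ p → contradiction p ¬p) λ ()

Bit : Vec ℕ 3 → Set
Bit (n ∷ a ∷ b ∷ []) = β a b n ≡ 0

bitD : Def Bit
bitD = iffD (βF (varF (# 1)) (varF (# 2)) (varF (# 0)) ≡D zeroF) λ { (n ∷ a ∷ b ∷ []) → mk⇔ id id }

-- The environment of the matrix is n ∷ a ∷ p ∷ b ∷ k ∷ [].
α-slots : Fin 2 → Fin 5
α-slots = lookup (# 0 ∷ # 2 ∷ [])

bit-slots : Fin 3 → Fin 5
bit-slots = lookup (# 0 ∷ # 1 ∷ # 3 ∷ [])

-- The order of the quantifiers matters: `b` comes before `p`, so `p` may later be chosen in terms
-- of `b`. The inner existential says that `n` is at most `k`.
diagonal : Formula 3 → Formula 2 → Sentence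
diagonal bit α = ∀ᶠ (∃ᶠ (∀ᶠ (∃ᶠ (∀ᶠ (∃ᶠ ((var (# 1) +ᵗ var (# 0)) ≐ var (# 5)) ⇒ ((α′ ⇒ bit′) ∧ᶠ (bit′ ⇒ α′)))))))
  where
  α′ = rename α-slots α
  bit′ = rename bit-slots bit

α-lookup : ∀ {A : Set} {n a p b k : A} i →
         lookup (n ∷ a ∷ p ∷ b ∷ k ∷ []) (α-slots i) ≡ lookup (n ∷ p ∷ []) i
α-lookup zero = refl
α-lookup (suc zero) = refl

bit-lookup : ∀ {A : Set} {n a p b k : A} i →
           lookup (n ∷ a ∷ p ∷ b ∷ k ∷ []) (bit-slots i) ≡ lookup (n ∷ a ∷ b ∷ []) i
bit-lookup zero = refl
bit-lookup (suc zero) = refl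
bit-lookup (suc (suc zero)) = refl

-- For fixed `p` the formula `α` cuts out some set of numbers `n`, and `code-set` codes its part up
-- to `k` with a `b` depending on `k` alone.
diagonal-std : ExcludedMiddle 0ℓ → (bit : Def Bit) → ∀ α → Models ℕ-std (diagonal (formula bit) α)
diagonal-std em bit α k = let b , code = code-set em k in b , λ p →
  let a , eq = code (λ n → Sat ℕ-std α (n ∷ p ∷ []))
      α⇔ n = rename-sat ℕ-std _ α (α-lookup {n = n} {a} {p} {b} {k})
      bit⇔ n = rename-sat ℕ-std _ (formula bit) (bit-lookup {n = n} {a} {p} {b} {k})
  in a , λ n (w , n+w≡k) →
     let n≤k = subst (n ≤_) n+w≡k (m≤m+n n w) in
     (λ s → from (bit⇔ n) (from (sat⇔ bit _) (to (eq n n≤k) (to (α⇔ n) s)))) ,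
     (λ s → from (α⇔ n) (from (eq n n≤k) (to (sat⇔ bit _) (to (bit⇔ n) s))))

-- Numerals and transfer between ℕ and the quotient

module TrueArithmetic (em : ExcludedMiddle 0ℓ) (_⊕_ _⊗_ : ℕ → ℕ → ℕ) (E : ℕ → ℕ → Set)
  (equiv : IsEquivalence E) (ta : ModelOfTA (Quot _⊕_ _⊗_ E)) where

  M : Structure
  M = Quot _⊕_ _⊗_ E

  zero-exists : ∃ λ z → Sat M (isZero zero) (z ∷ [])
  zero-exists = proj₁ (ta (∃ᶠ (isZero zero))) (0 , refl)

  one-exists : ∃ λ o → Sat M (isOne zero) (o ∷ [])
  one-exists = proj₁ (ta (∃ᶠ (isOne zero))) (1 , refl , λ ())

  𝟘 𝟙 : ℕ
  𝟘 = proj₁ zero-exists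
  𝟙 = proj₁ one-exists

  ν : ℕ → ℕ
  ν zero = 𝟘
  ν (suc n) = ν n ⊕ 𝟙

  numeral-ν : ∀ {m} n {ρ : Vec ℕ m} → Sat M (numeral n) (ν n ∷ ρ)
  numeral-ν zero = proj₂ zero-exists
  numeral-ν (suc n) = ν n , numeral-ν n , 𝟙 , proj₂ one-exists , IsEquivalence.refl equiv

  -- Parameters are removed one at a time: in ℕ only `n` satisfies `numeral n`, so guarding by it
  -- closes the formula, and in `M` the guarded formula is instantiated at `ν n`. Thus `ν` is an
  -- elementary embedding.
  transfer : ∀ {m} (φ : Formula m) (ns : Vec ℕ m) → Sat ℕ-std φ ns → Sat M φ (map ν ns)
  transfer φ [] s = proj₁ (ta φ) s
  transfer φ (n ∷ ns) s =
    transfer (∀ᶠ (numeral n ⇒ φ)) ns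
      (λ x sx → subst (λ x → Sat ℕ-std φ (x ∷ ns)) (sym (numeral-std n sx)) s) (ν n) (numeral-ν n)

  transfer⇔ : ∀ {m} (φ : Formula m) (ns : Vec ℕ m) → Sat ℕ-std φ ns ⇔ Sat M φ (map ν ns)
  -- The converse is transfer of the negation.
  transfer⇔ φ ns = mk⇔ (transfer φ ns) λ s → decidable-stable em λ ¬s → transfer (φ ⇒ ⊥ᶠ) ns ¬s s

  ν-surjective⇒iso : (∀ y → ∃ λ n → E (ν n) y) → IsoToStd M
  ν-surjective⇒iso surj = record
    { h = ν
    ; inj = λ a b → from (transfer⇔ (var (# 0) ≐ var (# 1)) (a ∷ b ∷ []))
    ; surj = surj
    ; pres-+ = λ a b → transfer (var (# 0) ≐ (var (# 1) +ᵗ var (# 2))) (a + b ∷ a ∷ b ∷ []) refl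
    ; pres-* = λ a b → transfer (var (# 0) ≐ (var (# 1) *ᵗ var (# 2))) (a * b ∷ a ∷ b ∷ []) refl
    }

  nonstandard-element : ¬ IsoToStd M → ∃ λ k → ∀ n → ¬ E (ν n) k
  nonstandard-element ¬iso = decidable-stable em λ none →
    ¬iso (ν-surjective⇒iso λ y → decidable-stable em λ ¬std → none (y , λ n e → ¬std (n , e)))

  -- Induction on `n`. In ℕ, `x ≤ k` and `x ≠ k` give `x + 1 ≤ k`; this sentence transfers, and a
  -- nonstandard `k` never equals a numeral.
  numerals-below : ∀ {k} → (∀ n → ¬ E (ν n) k) → ∀ n → ∃ λ w → E (ν n ⊕ w) k
  numerals-below {k} nonstd zero =
    proj₁ (ta (∀ᶠ (∀ᶠ (isZero (# 1) ⇒ ∃ᶠ ((var (# 2) +ᵗ var (# 0)) ≐ var (# 1))))))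
      (λ z k s → k , cong (_+ k) (to (double-fixed z) s)) 𝟘 k (proj₂ zero-exists)
  numerals-below {k} nonstd (suc n) =
    proj₁ (ta (∀ᶠ (∀ᶠ (∀ᶠ (isOne (# 2) ⇒ (((var (# 1) ≐ var (# 0)) ⇒ ⊥ᶠ) ⇒
                (∃ᶠ ((var (# 2) +ᵗ var (# 0)) ≐ var (# 1)) ⇒
                 ∃ᶠ (((var (# 2) +ᵗ var (# 3)) +ᵗ var (# 0)) ≐ var (# 1)))))))))
      successor-below 𝟙 (ν n) k (proj₂ one-exists) (nonstd n) (numerals-below nonstd n)
    where
    successor-below : ∀ o x k → (o * o ≡ o × (o + o ≡ o → ⊥)) → (x ≡ k → ⊥) →
                      (∃ λ w → x + w ≡ k) → ∃ λ w → x + o + w ≡ k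
    successor-below o x k one x≢k (zero , eq) = contradiction (trans (sym (+-identityʳ x)) eq) x≢k
    successor-below o x k one x≢k (suc w , eq) with refl ← to (idempotent-nonzero o) one =
      w , trans (+-assoc x 1 w) eq

  -- With `p` fixed, each `a` names the set of `n` such that `M` satisfies `φ` at `ν n`, `a`, `p`.
  -- This is Russell's set of those `n` outside the set that they name: `n` serves both as the index
  -- of a numeral and as a representative of an element.
  Escapes : Formula 3 → Vec ℕ 2 → Set
  Escapes φ ρ = ¬ Sat M φ (ν (head ρ) ∷ head ρ ∷ head (tail ρ) ∷ [])

  escape-undefinable : ∀ {k} → (∀ n → ¬ E (ν n) k) → (bit : Def Bit) → ¬ Def (Escapes (formula bit))
  escape-undefinable {k} nonstd bit α =
    let b , code-b = proj₁ (ta (diagonal (formula bit) (formula α))) (diagonal-std em bit (formula α)) k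
        a , code-a = code-b (ν b)
    in refute b a (code-a (ν a) (numerals-below nonstd a))
    where
    φ = formula α
    ψ = formula bit
    refute : ∀ b a → (Sat M (rename α-slots φ) (ν a ∷ a ∷ ν b ∷ b ∷ k ∷ []) →
                      Sat M (rename bit-slots ψ) (ν a ∷ a ∷ ν b ∷ b ∷ k ∷ [])) ×
                     (Sat M (rename bit-slots ψ) (ν a ∷ a ∷ ν b ∷ b ∷ k ∷ []) →
                      Sat M (rename α-slots φ) (ν a ∷ a ∷ ν b ∷ b ∷ k ∷ [])) → ⊥
    refute b a (⇒bit , bit⇒) = ¬bit (to bit⇔ (⇒bit (from α⇔ (from φ⇔ ¬bit))))
      where
      α⇔ = rename-sat M _ φ (α-lookup {n = ν a} {a} {ν b} {b} {k})
      bit⇔ = rename-sat M _ ψ (bit-lookup {n = ν a} {a} {ν b} {b} {k})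
      -- At numerals `M` agrees with ℕ about `φ`, and in ℕ this formula defines `Escapes ψ`.
      φ⇔ : Sat M φ (ν a ∷ ν b ∷ []) ⇔ Escapes ψ (a ∷ b ∷ [])
      φ⇔ = ⇔-trans (⇔-sym (transfer⇔ φ (a ∷ b ∷ []))) (sat⇔ α (a ∷ b ∷ []))
      ¬bit : Escapes ψ (a ∷ b ∷ [])
      ¬bit s = to φ⇔ (to α⇔ (bit⇒ (from bit⇔ s))) s

  -- Definability of satisfaction in the quotient

  module _ (⊕F : DFun (λ (ρ : Vec ℕ 2) → head ρ ⊕ head (tail ρ)))
           (⊗F : DFun (λ (ρ : Vec ℕ 2) → head ρ ⊗ head (tail ρ)))
           (ED : Def (λ (ρ : Vec ℕ 2) → E (head ρ) (head (tail ρ)))) where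

    termF : ∀ {n} (t : Term n) → DFun (⟦_⟧ᵗ M t)
    termF (var i) = varF i
    termF (s +ᵗ t) = composeF ⊕F (termF s ∷E termF t ∷E []E)
    termF (s *ᵗ t) = composeF ⊗F (termF s ∷E termF t ∷E []E)

    -- Elements of the quotient are represented by numbers, so its quantifiers are quantifiers over
    -- ℕ. The recursion runs outside the language and yields a separate definition for each `φ`, in
    -- keeping with Tarski's theorem.
    satD : ∀ {n} (φ : Formula n) → Def (Sat M φ)
    satD (s ≐ t) = substD ED (termF s ∷E termF t ∷E []E)
    satD ⊥ᶠ = ⊥D
    satD (φ ⇒ ψ) = satD φ ⇒D satD ψ
    satD (φ ∧ᶠ ψ) = satD φ ×D satD ψ
    satD (φ ∨ᶠ ψ) = satD φ ⊎D satD ψ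
    satD (∀ᶠ φ) = ∀D (satD φ)
    satD (∃ᶠ φ) = ∃D (satD φ)

    escapesD : DFun (λ (ρ : Vec ℕ 1) → ν (head ρ)) → ∀ φ → Def (Escapes φ)
    escapesD νF φ = substD (satD φ)
      (composeF νF (headF ∷E []E) ∷E headF ∷E weakenF headF ∷E []E) ⇒D ⊥D

theorem5 : ExcludedMiddle 0ℓ →
    (_⊕_ _⊗_ : ℕ → ℕ → ℕ) (E : ℕ → ℕ → Set) →
    Computable₂ _⊕_ → Computable₂ _⊗_ →
    IsEquivalence E → Congruence _⊕_ _⊗_ E → CoCE₂ E →
    ¬ NonstandardModelOfTA (Quot _⊕_ _⊗_ E)
theorem5 em _⊕_ _⊗_ E comp⊕@(c , ev) comp⊗ equiv _ coce (ta , ¬iso) =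
  escape-undefinable (proj₂ (nonstandard-element ¬iso)) bitD
    (escapesD (computable₂F comp⊕) (computable₂F comp⊗) (co-ceD em coce) νF (formula bitD))
  where
  open TrueArithmetic em _⊕_ _⊗_ E equiv ta
  -- `ν` iterates adding `𝟙` from `𝟘`: a primitive recursion over the code of `⊕` with two fixed
  -- numbers built in, where `proj` at index 1 reads the previous value.
  ν-code : Code 1
  ν-code = prim (const 𝟘) (comp c (proj (# 1) ∷ const 𝟙 ∷ []))
  ν-eval : ∀ n → Eval ν-code (n ∷ []) (ν n)
  ν-eval zero = ev-prim-z (const-eval 𝟘)
  ν-eval (suc n) = ev-prim-s (ν-eval n) (ev-comp (ev-proj (# 1) ∷ const-eval 𝟙 ∷ []) (ev (ν n) 𝟙))
  νF : DFun (λ ρ → ν (head ρ))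
  νF = computableF ν-code λ { (n ∷ []) → ν-eval n }
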